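{- Let $\mathcal{C}$ be a covering of a finite set $U$ with $|U|=m$, such that there are no two distinct elements $u,v\in U$ with $\mathcal{C}(\{u\})=\mathcal{C}(\{v\})$ and $|\mathcal{C}(\{u\})|=1$. Let $n\geq 1$ and let $P_n$ be the lattice of partitions of an $n$-element set. If $P_n\cong L(\mathcal{C})$, then $n\leq 3$. Moreover, if $n=3$, then $m=3$ and $k=1$, where $k:=|\mathcal{E}|$.
   Context: A covering of a finite set $U$ is a collection $\mathcal{C}\subseteq 2^U$ of subsets of $U$ whose union is $U$. For $H\subseteq U$, $\mathcal{C}(H):=\{C\in\mathcal{C} : C\cap H\neq\emptyset\}$. The matroid $M(\mathcal{C})$ is the transversal matroid of $\mathcal{C}$ on the ground set $U$: its independent sets are the partial transversals of $\mathcal{C}$, i.e. the sets $I\subseteq U$ for which there is an injective map $\varphi:I\to\mathcal{C}$ with $e\in\varphi(e)$ for all $e\in I$. $L(\mathcal{C})$ is the lattice of closed sets (flats) of $M(\mathcal{C})$ ordered by inclusion. $P_n$ is ordered by refinement: $\pi\leq\sigma$ if every block of $\pi$ is contained in a block of $\sigma$. For $x\in U$ with $|\mathcal{C}(\{x\})|=2$, $E(\{x\}):=\{y\in U : \mathcal{C}(\{y\})\subseteq\mathcal{C}(\{x\})\}$, and $\mathcal{E}:=\{E(\{x\}) : x\in U,\ |\mathcal{C}(\{x\})|=2\}$. -}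

module Defs where

open import Level using (Level; 0ℓ; _⊔_)
open import Data.Bool.Properties using () renaming (_≟_ to _≟ᵇ_)
open import Data.Fin using (Fin)
open import Data.Fin.Subset
  using (Subset; _∈_; _⊆_; _∩_; _∪_; ⋃; ⁅_⁆; ⊤; Nonempty; Empty; ∣_∣)
open import Data.Fin.Subset.Properties
  using (nonempty?; ⊆-refl; ⊆-trans; ⊆-antisym; ⊆-poset; x∈p∩q⁺)
open import Data.List using (List; []; _∷_; map; filter; length; allFin; deduplicate)
import Data.List.Membership.Propositional as ListMembership
import Data.List.Relation.Binary.Subset.DecPropositional as DecListSubset
open import Data.List.Relation.Binary.BagAndSetEquality using (_∼[_]_; set; [_]-Equality)
open import Data.List.Relation.Unary.Unique.Propositional using (Unique)
open import Data.Nat using (ℕ; _≤_; _≟_)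
open import Data.Product using (Σ; Σ-syntax; ∃-syntax; _×_; _,_; proj₁; proj₂)
open import Data.Vec using (tabulate)
open import Data.Vec.Properties using (≡-dec)
open import Function.Bundles using (_⇔_; mk⇔; Equivalence)
open import Relation.Binary using (Poset; Setoid; DecidableEquality)
open import Relation.Binary.Morphism.Structures using (IsOrderIsomorphism)
import Relation.Binary.Construct.On as On
open import Relation.Binary.PropositionalEquality using (_≡_; _≢_; sym; subst)
open import Relation.Nullary.Decidable using (does; decidable-stable)
open import Relation.Unary using (Pred)

_∈ₗ_ : ∀ {m} → Subset m → List (Subset m) → Set
_∈ₗ_ = ListMembership._∈_

infix 4 _∈ₗ_

_≟ˢ_ : ∀ {m} → DecidableEquality (Subset m)
_≟ˢ_ = ≡-dec _≟ᵇ_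

infix 4 _≅_

_≅_ : {a b c d e f : Level} → Poset a b c → Poset d e f → Set (a ⊔ b ⊔ c ⊔ d ⊔ e ⊔ f)
P ≅ Q = ∃[ f ] IsOrderIsomorphism P._≈_ Q._≈_ P._≤_ Q._≤_ f
  where
  module P = Poset P
  module Q = Poset Q

-- A collection of subsets of an m-element set is a duplicate-free list, so that
-- `length` is the cardinality of the collection.  The empty set may be a member.
record Covering (m : ℕ) : Set where
  field
    members : List (Subset m)
    unique  : Unique members
    covers  : ⋃ members ≡ ⊤

open Covering public

_⟨_⟩ : ∀ {m} → Covering m → Subset m → List (Subset m)
𝒞 ⟨ H ⟩ = filter (λ C → nonempty? (C ∩ H)) (members 𝒞)

E⟨_⟩ : ∀ {m} → Covering m → Fin m → Subset m
E⟨ 𝒞 ⟩ x = tabulate λ y → does ((𝒞 ⟨ ⁅ y ⁆ ⟩) ⊆? (𝒞 ⟨ ⁅ x ⁆ ⟩))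
  where open DecListSubset _≟ˢ_ using (_⊆?_)

-- Deduplicated: distinct x may give the same set E({x}).
ℰ : ∀ {m} → Covering m → List (Subset m)
ℰ {m} 𝒞 =
  deduplicate _≟ˢ_
    (map E⟨ 𝒞 ⟩ (filter (λ x → length (𝒞 ⟨ ⁅ x ⁆ ⟩) ≟ 2) (allFin m)))

-- φ is given on the whole ground set, but only its values on I matter.
PartialTransversal : ∀ {m} → Covering m → Pred (Subset m) 0ℓ
PartialTransversal {m} 𝒞 I =
  Σ[ φ ∈ (Fin m → Subset m) ]
    (∀ {e} → e ∈ I → φ e ∈ₗ members 𝒞 × e ∈ φ e) ×
    (∀ {e f} → e ∈ I → f ∈ I → φ e ≡ φ f → e ≡ f)

module Matroid {m : ℕ} (Independent : Pred (Subset m) 0ℓ) where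

  -- r is the rank of X: the largest size of an independent subset of X.
  HasRank : Subset m → ℕ → Set
  HasRank X r =
    (∃[ I ] I ⊆ X × Independent I × ∣ I ∣ ≡ r) ×
    (∀ {I} → I ⊆ X → Independent I → ∣ I ∣ ≤ r)

  -- cl(X) = { e : r(X ∪ e) = r(X) }
  InClosure : Subset m → Fin m → Set
  InClosure X e = ∃[ r ] HasRank X r × HasRank (X ∪ ⁅ e ⁆) r

  Closed : Subset m → Set
  Closed F = ∀ {e} → InClosure F e ⇔ e ∈ F

  Flat : Set
  Flat = Σ (Subset m) Closed

  flats : Poset 0ℓ 0ℓ 0ℓ
  flats = On.poset (⊆-poset m) (proj₁ {B = Closed})

L : ∀ {m} → Covering m → Poset 0ℓ 0ℓ 0ℓ
L 𝒞 = Matroid.flats (PartialTransversal 𝒞)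

-- The list of blocks stands for the set of its members; repetitions are
-- harmless because partitions are compared by set equality of their blocks.
record Partition (n : ℕ) : Set where
  field
    blocks   : List (Subset n)
    nonempty : ∀ {B} → B ∈ₗ blocks → Nonempty B
    disjoint : ∀ {B B′} → B ∈ₗ blocks → B′ ∈ₗ blocks → B ≢ B′ → Empty (B ∩ B′)
    covers   : ⋃ blocks ≡ ⊤

module _ {n : ℕ} where
  open Partition

  infix 4 _≈ₚ_ _≤ₚ_

  _≈ₚ_ : Partition n → Partition n → Set
  π ≈ₚ σ = blocks π ∼[ set ] blocks σ

  _≤ₚ_ : Partition n → Partition n → Set
  π ≤ₚ σ = ∀ {B} → B ∈ₗ blocks π → ∃[ B′ ] B′ ∈ₗ blocks σ × B ⊆ B′

  ≤ₚ-trans : ∀ {π σ τ} → π ≤ₚ σ → σ ≤ₚ τ → π ≤ₚ τ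
  ≤ₚ-trans π≤σ σ≤τ B∈π with π≤σ B∈π
  ... | _ , B′∈σ , B⊆B′ with σ≤τ B′∈σ
  ...   | B″ , B″∈τ , B′⊆B″ = B″ , B″∈τ , ⊆-trans B⊆B′ B′⊆B″

  private
    ⊆⇒≡ : ∀ π {B B′ : Subset n} → B ∈ₗ blocks π → B′ ∈ₗ blocks π → B ⊆ B′ → B ≡ B′
    ⊆⇒≡ π {B} {B′} B∈ B′∈ B⊆B′ with nonempty π B∈
    ... | x , x∈B = decidable-stable (B ≟ˢ B′) λ B≢B′ →
      disjoint π B∈ B′∈ B≢B′ (x , x∈p∩q⁺ (x∈B , B⊆B′ x∈B))

    blocks-⊆ : ∀ π σ → π ≤ₚ σ → σ ≤ₚ π → ∀ {B : Subset n} → B ∈ₗ blocks π → B ∈ₗ blocks σ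
    blocks-⊆ π σ π≤σ σ≤π B∈π with π≤σ B∈π
    ... | B′ , B′∈σ , B⊆B′ with σ≤π B′∈σ
    ...   | B″ , B″∈π , B′⊆B″ = subst (λ X → X ∈ₗ blocks σ) (⊆-antisym B′⊆B B⊆B′) B′∈σ
      where
      B≡B″ = ⊆⇒≡ π B∈π B″∈π (⊆-trans B⊆B′ B′⊆B″)
      B′⊆B = subst (B′ ⊆_) (sym B≡B″) B′⊆B″

  ≤ₚ-antisym : ∀ {π σ} → π ≤ₚ σ → σ ≤ₚ π → π ≈ₚ σ
  ≤ₚ-antisym {π} {σ} π≤σ σ≤π = mk⇔ (blocks-⊆ π σ π≤σ σ≤π) (blocks-⊆ σ π σ≤π π≤σ)

P : ℕ → Poset 0ℓ 0ℓ 0ℓ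
P n = record
  { Carrier        = Partition n
  ; _≈_            = _≈ₚ_
  ; _≤_            = _≤ₚ_
  ; isPartialOrder = record
    { isPreorder = record
      { isEquivalence =
          Setoid.isEquivalence (On.setoid ([ set ]-Equality (Subset n)) Partition.blocks)
      ; reflexive     = λ π≈σ {B} B∈π → B , Equivalence.to π≈σ B∈π , ⊆-refl
      ; trans         = λ {π σ τ} → ≤ₚ-trans {π = π} {σ} {τ}
      }
    ; antisym    = λ {π σ} → ≤ₚ-antisym {π = π} {σ}
    }
  }

{-# OPTIONS --safe #-}
module Submission where

-- The hypothesis makes M(𝒞) simple, so the elements of U are the atoms of L(𝒞); the atom of Pₙ
-- that joins i and j corresponds to an element x_ij.  For distinct i, j, k the elements x_ij,
-- x_ik, x_jk are pairwise independent but dependent together, so by Hall's theorem they meet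
-- only two members A, B of 𝒞, and by simplicity one of the three lies in both A and B.  If
-- there is a fourth index l, that element, say x_ij, also lies on the triangle ijl, so all five
-- elements of the two triangles meet only A and B.  Then x_il lies in the flat of the triangle
-- ijk, which it must not.  For n = 3 the three elements are all of U, they meet only A and B,
-- and E({x}) = U whenever x lies in both.
--
-- The existence of ranks is needed only up to double negation, because the conclusion is decidable.

open import Defs
open import Level using (0ℓ)
open import Data.Empty using (⊥-elim) renaming (⊥ to False)
open import Data.Fin using (Fin; zero; suc; _≟_)
open import Data.Fin.Patterns using (0F; 1F; 2F; 3F)
open import Data.Fin.Properties using (any?; injective⇒≤)
open import Data.Fin.Subset
  using (Subset; _∈_; _∉_; _⊆_; _∪_; _-_; _∩_; Nonempty; ⋃; ⁅_⁆; ⊤; ⊥; ∣_∣; inside; outside)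
open import Data.Fin.Subset.Properties
  using (_∈?_; ∉⊥; ⊥⊆; ∈⊤; x∈⁅x⁆; x∈⁅y⁆⇒x≡y; p⊆p∪q; q⊆p∪q; x∈p∪q⁺; x∈p∪q⁻; x∈p∩q⁺; x∈p∩q⁻;
         ⊆-refl; ⊆-trans; ⊆-antisym; ⊆⊤; ∣p∣≤n; p⊆q⇒∣p∣≤∣q∣; p⊂q⇒∣p∣<∣q∣; p─q⊆p;
         ∪-identityʳ; p─q─q≡p─q; x∈p⇒∣p-x∣<∣p∣; nonempty?; x∈p∧x≢y⇒x∈p-y)
open import Data.List using (List; []; _∷_; map; length; filter; allFin; deduplicate)
open import Data.List.Membership.Propositional using (find; lose)
open import Data.List.Membership.Propositional.Properties
  using (∈-filter⁺; ∈-filter⁻; ∈-map⁺; ∈-map⁻; ∈-allFin; ∈-deduplicate⁺; ∈-deduplicate⁻)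
open import Data.List.Membership.Propositional.Properties.WithK using (unique∧set⇒bag)
open import Data.List.Relation.Binary.BagAndSetEquality using (_∼[_]_; set; ∼bag⇒↭)
open import Data.List.Relation.Binary.Permutation.Propositional.Properties using (↭-length)
open import Data.List.Relation.Unary.All using ([]; _∷_)
open import Data.List.Relation.Unary.AllPairs using ([]; _∷_)
open import Data.List.Relation.Unary.Any as Any using (here; there)
open import Data.List.Relation.Unary.Unique.DecPropositional.Properties using (deduplicate-!)
open import Data.List.Relation.Unary.Unique.Propositional using (Unique)
import Data.List.Relation.Unary.Unique.Propositional.Properties as Unique
import Data.List.Relation.Binary.Subset.DecPropositional as DecListSubset
open import Data.Nat using (ℕ; zero; suc; _+_; _≤_; _<_; _≥_; z≤n; s≤s; _≤?_; _<?_)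
import Data.Nat as ℕ
open import Data.Nat.Properties
  using (≤-refl; ≤-trans; ≤-antisym; ≤-reflexive; <-irrefl; ≤∧≢⇒<; <⇒≱; m≤n⇒m≤1+n;
         +-suc; +-identityʳ; +-monoˡ-≤; m≤n+m; module ≤-Reasoning)
open import Data.Product using (Σ-syntax; ∃-syntax; _×_; _,_; proj₁; proj₂)
open import Data.Sum using (_⊎_; inj₁; inj₂; [_,_]′)
open import Data.Vec using (_∷_; []; tabulate)
open import Data.Vec.Functional using (updateAt)
open import Data.Vec.Functional.Properties using (updateAt-updates; updateAt-minimal)
open import Data.Vec.Properties using (lookup∘tabulate; lookup⇒[]=; []=⇒lookup)
open import Function using (_∘_; const; id)
open import Function.Bundles using (_⇔_; mk⇔; Equivalence)
open import Relation.Binary using (Poset)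
open import Relation.Binary.Morphism.Structures using (IsOrderIsomorphism)
open import Relation.Binary.PropositionalEquality
  using (_≡_; _≢_; refl; sym; trans; cong; subst; ≢-sym)
open import Relation.Nullary using (¬_; Dec; yes; no; contradiction; does)
open import Relation.Nullary.Decidable
  using (decidable-stable; dec-true; ¬?; _×-dec_; _⊎-dec_; _→-dec_; ¬¬-excluded-middle)
open import Relation.Unary using (Pred; Decidable)

open Equivalence using (to; from)

-- Counting in duplicate-free lists, and three values among two

unique∧set⇒length≡ : ∀ {A : Set} {xs ys : List A} → Unique xs → Unique ys →
  xs ∼[ set ] ys → length xs ≡ length ys
unique∧set⇒length≡ xs! ys! xs∼ys = ↭-length (∼bag⇒↭ (unique∧set⇒bag xs! ys! xs∼ys))

pair! : ∀ {A : Set} {x y : A} → x ≢ y → Unique (x ∷ y ∷ [])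
pair! x≢y = (x≢y ∷ []) ∷ [] ∷ []

pigeonhole₃ : ∀ {A : Set} {a b x y z : A} → x ≡ a ⊎ x ≡ b → y ≡ a ⊎ y ≡ b → z ≡ a ⊎ z ≡ b →
  x ≡ y ⊎ x ≡ z ⊎ y ≡ z
pigeonhole₃ (inj₁ refl) (inj₁ refl) _           = inj₁ refl
pigeonhole₃ (inj₁ refl) (inj₂ refl) (inj₁ refl) = inj₂ (inj₁ refl)
pigeonhole₃ (inj₁ refl) (inj₂ refl) (inj₂ refl) = inj₂ (inj₂ refl)
pigeonhole₃ (inj₂ refl) (inj₂ refl) _           = inj₁ refl
pigeonhole₃ (inj₂ refl) (inj₁ refl) (inj₂ refl) = inj₂ (inj₁ refl)
pigeonhole₃ (inj₂ refl) (inj₁ refl) (inj₁ refl) = inj₂ (inj₂ refl)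

-- Finite subsets

module _ {n : ℕ} where

  ∈-tabulate⁺ : ∀ {P : Pred (Fin n) 0ℓ} (P? : Decidable P) {i} → P i → i ∈ tabulate (does ∘ P?)
  ∈-tabulate⁺ P? {i} Pi =
    lookup⇒[]= i _ (trans (lookup∘tabulate (does ∘ P?) i) (dec-true (P? i) Pi))

  ∈-tabulate⁻ : ∀ {P : Pred (Fin n) 0ℓ} (P? : Decidable P) {i} → i ∈ tabulate (does ∘ P?) → P i
  ∈-tabulate⁻ P? {i} i∈ with P? i | trans (sym (lookup∘tabulate (does ∘ P?) i)) ([]=⇒lookup i∈)
  ... | yes Pi | _ = Pi

  x∈p∪⁅x⁆ : ∀ p (x : Fin n) → x ∈ p ∪ ⁅ x ⁆
  x∈p∪⁅x⁆ p x = q⊆p∪q p ⁅ x ⁆ (x∈⁅x⁆ x)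

  x∈p∪⁅y⁆⁻ : ∀ {p} {x y : Fin n} → x ∈ p ∪ ⁅ y ⁆ → x ∈ p ⊎ x ≡ y
  x∈p∪⁅y⁆⁻ {p} {y = y} x∈ with x∈p∪q⁻ p ⁅ y ⁆ x∈
  ... | inj₁ x∈p = inj₁ x∈p
  ... | inj₂ x∈y = inj₂ (x∈⁅y⁆⇒x≡y y x∈y)

  p∪⁅x⁆⊆ : ∀ {p q} {x : Fin n} → p ⊆ q → x ∈ q → p ∪ ⁅ x ⁆ ⊆ q
  p∪⁅x⁆⊆ p⊆q x∈q y∈ with x∈p∪⁅y⁆⁻ y∈
  ... | inj₁ y∈p  = p⊆q y∈p
  ... | inj₂ refl = x∈q

  ∪⁅⁆-mono : ∀ {p q} (x : Fin n) → p ⊆ q → p ∪ ⁅ x ⁆ ⊆ q ∪ ⁅ x ⁆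
  ∪⁅⁆-mono {q = q} x p⊆q = p∪⁅x⁆⊆ (⊆-trans p⊆q (p⊆p∪q _)) (x∈p∪⁅x⁆ q x)

  x∈p⇒p∪⁅x⁆≡p : ∀ {p} {x : Fin n} → x ∈ p → p ∪ ⁅ x ⁆ ≡ p
  x∈p⇒p∪⁅x⁆≡p x∈p = ⊆-antisym (p∪⁅x⁆⊆ ⊆-refl x∈p) (p⊆p∪q _)

  x∉p⇒∣p∣<∣p∪⁅x⁆∣ : ∀ {p} {x : Fin n} → x ∉ p → ∣ p ∣ < ∣ p ∪ ⁅ x ⁆ ∣
  x∉p⇒∣p∣<∣p∪⁅x⁆∣ {p} {x} x∉p = p⊂q⇒∣p∣<∣q∣ (p⊆p∪q _ , x , x∈p∪⁅x⁆ p x , x∉p)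

  ∈⋃⁺ : ∀ {ps p} {x : Fin n} → p ∈ₗ ps → x ∈ p → x ∈ ⋃ ps
  ∈⋃⁺ (here refl) x∈p = x∈p∪q⁺ (inj₁ x∈p)
  ∈⋃⁺ (there p∈)  x∈p = x∈p∪q⁺ (inj₂ (∈⋃⁺ p∈ x∈p))

  ∈⋃⁻ : ∀ ps {x : Fin n} → x ∈ ⋃ ps → ∃[ p ] p ∈ₗ ps × x ∈ p
  ∈⋃⁻ []       x∈ = contradiction x∈ ∉⊥
  ∈⋃⁻ (p ∷ ps) x∈ with x∈p∪q⁻ p (⋃ ps) x∈
  ... | inj₁ x∈p = p , here refl , x∈p
  ... | inj₂ x∈⋃ with ∈⋃⁻ ps x∈⋃
  ...   | q , q∈ , x∈q = q , there q∈ , x∈q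

∣p∪⁅x⁆∣≤1+∣p∣ : ∀ {n} (p : Subset n) x → ∣ p ∪ ⁅ x ⁆ ∣ ≤ suc ∣ p ∣
∣p∪⁅x⁆∣≤1+∣p∣ (inside  ∷ p) zero    rewrite ∪-identityʳ p = m≤n⇒m≤1+n ≤-refl
∣p∪⁅x⁆∣≤1+∣p∣ (outside ∷ p) zero    rewrite ∪-identityʳ p = ≤-refl
∣p∪⁅x⁆∣≤1+∣p∣ (inside  ∷ p) (suc x) = s≤s (∣p∪⁅x⁆∣≤1+∣p∣ p x)
∣p∪⁅x⁆∣≤1+∣p∣ (outside ∷ p) (suc x) = ∣p∪⁅x⁆∣≤1+∣p∣ p x

∣p∣≤1+∣p-x∣ : ∀ {n} (p : Subset n) x → ∣ p ∣ ≤ suc ∣ p - x ∣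
∣p∣≤1+∣p-x∣ p x = ≤-trans (p⊆q⇒∣p∣≤∣q∣ p⊆) (∣p∪⁅x⁆∣≤1+∣p∣ (p - x) x)
  where
  p⊆ : p ⊆ (p - x) ∪ ⁅ x ⁆
  p⊆ {y} y∈p with y ≟ x
  ... | yes refl = x∈p∪⁅x⁆ (p - x) x
  ... | no y≢x   = p⊆p∪q _ (x∈p∧x≢y⇒x∈p-y y∈p y≢x)

x∉p-x : ∀ {n} (p : Subset n) x → x ∉ p - x
x∉p-x p x x∈ = <-irrefl (cong ∣_∣ (p─q─q≡p─q p ⁅ x ⁆)) (x∈p⇒∣p-x∣<∣p∣ x∈)

-- Double negation commutes with a finite quantifier, by induction on the size of the ground set.
-- This allows the ranks of all subsets to be assumed at once.
¬¬-∀Subset : ∀ {n} {P : Pred (Subset n) 0ℓ} → (∀ X → ¬ ¬ P X) → ¬ ¬ (∀ X → P X)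
¬¬-∀Subset {zero}  ¬¬P k = ¬¬P [] λ P[] → k λ { [] → P[] }
¬¬-∀Subset {suc n} ¬¬P k =
  ¬¬-∀Subset (¬¬P ∘ (inside ∷_)) λ Pᵢ →
  ¬¬-∀Subset (¬¬P ∘ (outside ∷_)) λ Pₒ →
  k λ { (inside ∷ X) → Pᵢ X ; (outside ∷ X) → Pₒ X }

-- Rank and closed sets

module _ {m : ℕ} (Independent : Pred (Subset m) 0ℓ) (∅-independent : Independent ⊥) where
  open Matroid Independent

  -- The search descends from the trivial bound `m`: either some independent subset attains the
  -- bound, which is then the rank, or the bound drops by one. The choice is made by excluded
  -- middle, hence the double negation.
  ¬¬-hasRank : ∀ X → ¬ ¬ (∃[ r ] HasRank X r)
  ¬¬-hasRank X = search m (λ {I} _ _ → ∣p∣≤n I)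
    where
    search : ∀ k → (∀ {I} → I ⊆ X → Independent I → ∣ I ∣ ≤ k) → ¬ ¬ (∃[ r ] HasRank X r)
    search zero bound k =
      k (0 , (⊥ , ⊥⊆ , ∅-independent , ≤-antisym (bound ⊥⊆ ∅-independent) z≤n) , bound)
    search (suc r) bound k = ¬¬-excluded-middle λ
      { (yes witness) → k (suc r , witness , bound)
      ; (no ¬witness) → search r
          (λ {I} I⊆X ind → ℕ.s≤s⁻¹ (≤∧≢⇒< (bound I⊆X ind)
            λ ∣I∣≡ → ¬witness (I , I⊆X , ind , ∣I∣≡))) k
      }

  module Ranked (ranked : ∀ X → ∃[ r ] HasRank X r) where

    ρ : Subset m → ℕ
    ρ X = proj₁ (ranked X)

    ∣I∣≤rank : ∀ {X I r} → HasRank X r → I ⊆ X → Independent I → ∣ I ∣ ≤ r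
    ∣I∣≤rank (_ , bound) = bound

    hasRank-mono : ∀ {X Y r s} → HasRank X r → HasRank Y s → X ⊆ Y → r ≤ s
    hasRank-mono ((I , I⊆X , ind , refl) , _) (_ , bound) X⊆Y = bound (⊆-trans I⊆X X⊆Y) ind

    rank≤size : ∀ {X r} → HasRank X r → r ≤ ∣ X ∣
    rank≤size ((I , I⊆X , _ , refl) , _) = p⊆q⇒∣p∣≤∣q∣ I⊆X

    ∈⇒inClosure : ∀ {X e} → e ∈ X → InClosure X e
    ∈⇒inClosure {X} e∈X =
      ρ X , proj₂ (ranked X) , subst (λ Y → HasRank Y (ρ X)) (sym (x∈p⇒p∪⁅x⁆≡p e∈X)) (proj₂ (ranked X))

    independent⇒rank< : ∀ {X e r s} → e ∉ X → Independent (X ∪ ⁅ e ⁆) →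
      HasRank X r → HasRank (X ∪ ⁅ e ⁆) s → r < s
    independent⇒rank< {X} e∉X ind X-r Xe-s = ≤-trans (s≤s (rank≤size X-r))
      (≤-trans (x∉p⇒∣p∣<∣p∪⁅x⁆∣ {p = X} e∉X) (∣I∣≤rank Xe-s ⊆-refl ind))

    -- The rank of X is at most its size, so an independent X ∪ {e} with e outside X has strictly
    -- larger rank, and e is not in the closure.
    independent-extensions⇒closed : ∀ {X} → (∀ {e} → e ∉ X → Independent (X ∪ ⁅ e ⁆)) → Closed X
    independent-extensions⇒closed {X} ext {e} = mk⇔
      (λ { (r , X-r , Xe-r) → decidable-stable (e ∈? X)
             λ e∉X → <-irrefl refl (independent⇒rank< e∉X (ext e∉X) X-r Xe-r) })
      ∈⇒inClosure

    -- F grows as long as it does not span c; when it is maximal with this property it is closed,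
    -- by monotonicity of the rank alone.
    abstract
      separating-flat : ∀ {X c} → c ∉ X → Independent (X ∪ ⁅ c ⁆) →
        ∃[ F ] Closed F × X ⊆ F × c ∉ F
      separating-flat {X} {c} c∉X ind =
        grow m X (m≤n+m m ∣ X ∣)
          (independent⇒rank< c∉X ind (proj₂ (ranked X)) (proj₂ (ranked (X ∪ ⁅ c ⁆))))
        where
        -- The fuel `k` bounds the number of elements outside F. When it reaches zero, F is the
        -- whole ground set and no further `e` exists.
        grow : ∀ k F → m ≤ ∣ F ∣ + k → ρ F < ρ (F ∪ ⁅ c ⁆) → ∃[ G ] Closed G × F ⊆ G × c ∉ G
        grow k F fuel ρF<ρFc
          with any? (λ e → ¬? (e ∈? F) ×-dec (ρ (F ∪ ⁅ e ⁆) <? ρ ((F ∪ ⁅ e ⁆) ∪ ⁅ c ⁆)))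
        ... | no maximal = F , closed , ⊆-refl , c∉F
          where
          c∉F : c ∉ F
          c∉F c∈F = <-irrefl (cong ρ (sym (x∈p⇒p∪⁅x⁆≡p c∈F))) ρF<ρFc
          closed : Closed F
          closed {e} = mk⇔
            -- If `e` were in the closure but outside F, adding it would leave the rank at `ρ F`,
            -- and the gap to `c` would persist; so F could still grow.
            (λ { (r , F-r , Fe-r) → decidable-stable (e ∈? F) λ e∉F → maximal (e , e∉F ,
              (begin-strict
                ρ (F ∪ ⁅ e ⁆)           ≤⟨ hasRank-mono (proj₂ (ranked _)) Fe-r ⊆-refl ⟩
                r                       ≤⟨ hasRank-mono F-r (proj₂ (ranked F)) ⊆-refl ⟩
                ρ F                     <⟨ ρF<ρFc ⟩
                ρ (F ∪ ⁅ c ⁆)           ≤⟨ hasRank-mono (proj₂ (ranked _)) (proj₂ (ranked _))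
                                             (∪⁅⁆-mono c (p⊆p∪q _)) ⟩
                ρ ((F ∪ ⁅ e ⁆) ∪ ⁅ c ⁆) ∎)) })
            ∈⇒inClosure
            where open ≤-Reasoning
        grow zero F fuel _ | yes (e , e∉F , _) = contradiction
          (≤-trans (x∉p⇒∣p∣<∣p∪⁅x⁆∣ {p = F} e∉F) (∣p∣≤n (F ∪ ⁅ e ⁆)))
          (<⇒≱ (s≤s (subst (m ≤_) (+-identityʳ _) fuel)))
        grow (suc k) F fuel _ | yes (e , e∉F , gap)
          with grow k (F ∪ ⁅ e ⁆) (≤-trans fuel (≤-trans (≤-reflexive (+-suc ∣ F ∣ k))
                 (+-monoˡ-≤ k (x∉p⇒∣p∣<∣p∪⁅x⁆∣ {p = F} e∉F)))) gap
        ... | G , closed , Fe⊆G , c∉G = G , closed , ⊆-trans (p⊆p∪q _) Fe⊆G , c∉G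

-- Partitions

module _ {n : ℕ} where

  -- The equivalence relation of a partition. Refinement becomes inclusion of these relations, so
  -- block lists need not be compared below.
  Same : Partition n → Fin n → Fin n → Set
  Same π i j = ∃[ B ] B ∈ₗ Partition.blocks π × i ∈ B × j ∈ B

  same? : ∀ π i j → Dec (Same π i j)
  same? π i j with Any.any? (λ B → (i ∈? B) ×-dec (j ∈? B)) (Partition.blocks π)
  ... | yes p = yes (find p)
  ... | no ¬p = no λ { (B , B∈ , ij∈) → ¬p (lose B∈ ij∈) }

  same-refl : ∀ π i → Same π i i
  same-refl π i with ∈⋃⁻ (Partition.blocks π) (subst (i ∈_) (sym (Partition.covers π)) ∈⊤)
  ... | B , B∈ , i∈B = B , B∈ , i∈B , i∈B

  same-sym : ∀ π {i j} → Same π i j → Same π j i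
  same-sym π (B , B∈ , i∈B , j∈B) = B , B∈ , j∈B , i∈B

  same-trans : ∀ π {i j k} → Same π i j → Same π j k → Same π i k
  same-trans π {j = j} (B , B∈ , i∈B , j∈B) (C , C∈ , j∈C , k∈C)
    with B ≟ˢ C
  ... | yes refl = B , B∈ , i∈B , k∈C
  ... | no B≢C   = contradiction (j , x∈p∩q⁺ (j∈B , j∈C)) (Partition.disjoint π B∈ C∈ B≢C)

  ≤ₚ⇒same : ∀ {π σ : Partition n} {i j} → π ≤ₚ σ → Same π i j → Same σ i j
  ≤ₚ⇒same π≤σ (B , B∈ , i∈B , j∈B) with π≤σ B∈
  ... | B′ , B′∈ , B⊆B′ = B′ , B′∈ , B⊆B′ i∈B , B⊆B′ j∈B

  same⇒≤ₚ : ∀ {π σ : Partition n} → (∀ {i j} → Same π i j → Same σ i j) → π ≤ₚ σ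
  same⇒≤ₚ {π} {σ} same {B} B∈ with Partition.nonempty π B∈
  ... | i , i∈B with same-refl σ i
  ...   | C , C∈ , i∈C , _ = C , C∈ , λ {j} j∈B → in-C j (same (B , B∈ , i∈B , j∈B))
    where
    in-C : ∀ j → Same σ i j → j ∈ C
    in-C j (D , D∈ , i∈D , j∈D) with C ≟ˢ D
    ... | yes refl = j∈D
    ... | no C≢D   = contradiction (i , x∈p∩q⁺ (i∈C , i∈D)) (Partition.disjoint σ C∈ D∈ C≢D)

  -- The partition whose only block with more than one element is X (if ∣ X ∣ > 1).
  module _ (X : Subset n) where

    private
      _∼_ : Fin n → Fin n → Set
      i ∼ j = i ≡ j ⊎ (i ∈ X × j ∈ X)

      ∼-sym : ∀ {i j} → i ∼ j → j ∼ i
      ∼-sym (inj₁ refl)      = inj₁ refl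
      ∼-sym (inj₂ (i∈ , j∈)) = inj₂ (j∈ , i∈)

      ∼-trans : ∀ {i j k} → i ∼ j → j ∼ k → i ∼ k
      ∼-trans (inj₁ refl)     j∼k             = j∼k
      ∼-trans i∼j             (inj₁ refl)     = i∼j
      ∼-trans (inj₂ (i∈ , _)) (inj₂ (_ , k∈)) = inj₂ (i∈ , k∈)

      _∼?_ : ∀ i j → Dec (i ∼ j)
      i ∼? j = (i ≟ j) ⊎-dec ((i ∈? X) ×-dec (j ∈? X))

      class : Fin n → Subset n
      class i = tabulate (does ∘ (i ∼?_))

      class-mono : ∀ {i j} → i ∼ j → class j ⊆ class i
      class-mono {i} {j} i∼j k∈ = ∈-tabulate⁺ (i ∼?_) (∼-trans i∼j (∈-tabulate⁻ (j ∼?_) k∈))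

      class-cong : ∀ {i j} → i ∼ j → class i ≡ class j
      class-cong i∼j = ⊆-antisym (class-mono (∼-sym i∼j)) (class-mono i∼j)

      ∈class : ∀ i → i ∈ class i
      ∈class i = ∈-tabulate⁺ (i ∼?_) (inj₁ refl)

      classes : List (Subset n)
      classes = map class (allFin n)

      class∈ : ∀ i → class i ∈ₗ classes
      class∈ i = ∈-map⁺ class (∈-allFin i)

    merge : Partition n
    merge = record
      { blocks   = classes
      ; nonempty = λ B∈ → let i , _ , B≡ = ∈-map⁻ class B∈ in
                     i , subst (i ∈_) (sym B≡) (∈class i)
      ; disjoint = disjoint
      ; covers   = ⊆-antisym ⊆⊤ (λ {i} _ → ∈⋃⁺ (class∈ i) (∈class i))
      }
      where
      disjoint : ∀ {B B′} → B ∈ₗ classes → B′ ∈ₗ classes → B ≢ B′ → _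
      disjoint B∈ B′∈ B≢B′ (k , k∈) with ∈-map⁻ class B∈ | ∈-map⁻ class B′∈
      ... | i , _ , refl | j , _ , refl with x∈p∩q⁻ (class i) (class j) k∈
      ...   | k∈i , k∈j = B≢B′ (class-cong
              (∼-trans (∈-tabulate⁻ (i ∼?_) k∈i) (∼-sym (∈-tabulate⁻ (j ∼?_) k∈j))))

    same-merge⁺ : ∀ {i j} → i ∈ X → j ∈ X → Same merge i j
    same-merge⁺ {i} i∈ j∈ = class i , class∈ i , ∈class i , ∈-tabulate⁺ (i ∼?_) (inj₂ (i∈ , j∈))

    same-merge⁻ : ∀ {i j} → Same merge i j → i ≡ j ⊎ (i ∈ X × j ∈ X)
    same-merge⁻ (B , B∈ , i∈B , j∈B) with ∈-map⁻ class B∈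
    ... | k , _ , refl = ∼-trans (∼-sym (∈-tabulate⁻ (k ∼?_) i∈B)) (∈-tabulate⁻ (k ∼?_) j∈B)

-- Transversal matroids

module _ {m : ℕ} (𝒞 : Covering m) where

  N : Fin m → List (Subset m)
  N x = 𝒞 ⟨ ⁅ x ⁆ ⟩

  Independent : Pred (Subset m) 0ℓ
  Independent = PartialTransversal 𝒞

  open Matroid Independent using (Closed; InClosure; HasRank)

  meets? : ∀ x (C : Subset m) → Dec (Nonempty (C ∩ ⁅ x ⁆))
  meets? x C = nonempty? (C ∩ ⁅ x ⁆)

  ∈N⁺ : ∀ {S x} → S ∈ₗ members 𝒞 × x ∈ S → S ∈ₗ N x
  ∈N⁺ {x = x} (S∈ , x∈S) = ∈-filter⁺ (meets? x) S∈ (x , x∈p∩q⁺ (x∈S , x∈⁅x⁆ x))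

  ∈N⁻ : ∀ {S x} → S ∈ₗ N x → S ∈ₗ members 𝒞 × x ∈ S
  ∈N⁻ {S} {x} S∈N with ∈-filter⁻ (meets? x) S∈N
  ... | S∈ , y , y∈ with x∈p∩q⁻ S ⁅ x ⁆ y∈
  ...   | y∈S , y∈x = S∈ , subst (_∈ S) (x∈⁅y⁆⇒x≡y x y∈x) y∈S

  N-nonempty : ∀ x → ∃[ S ] S ∈ₗ N x
  N-nonempty x with ∈⋃⁻ (members 𝒞) (subst (x ∈_) (sym (covers 𝒞)) ∈⊤)
  ... | S , S∈x = S , ∈N⁺ S∈x

  N! : ∀ x → Unique (N x)
  N! x = Unique.filter⁺ (meets? x) (unique 𝒞)

  Matching : Subset m → (Fin m → Subset m) → Set
  Matching K φ = (∀ {e} → e ∈ K → φ e ∈ₗ members 𝒞 × e ∈ φ e) ×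
                 (∀ {e f} → e ∈ K → f ∈ K → φ e ≡ φ f → e ≡ f)

  -- Since x ∈ K is allowed, this also covers rematching an element of K.
  extend : ∀ {K φ S} x → Matching K φ → S ∈ₗ N x → (∀ {e} → e ∈ K → e ≢ x → φ e ≢ S) →
    Matching (K ∪ ⁅ x ⁆) (updateAt φ x (const S))
  extend {K} {φ} {S} x (valid , inj) S∈N free = valid′ , λ {e} {f} → inj′ e f
    where
    φ′ = updateAt φ x (const S)

    φ′x : φ′ x ≡ S
    φ′x = updateAt-updates x φ

    φ′e : ∀ {e} → e ≢ x → φ′ e ≡ φ e
    φ′e {e} e≢x = updateAt-minimal e x φ e≢x

    old : ∀ {e} → e ∈ K ∪ ⁅ x ⁆ → e ≢ x → e ∈ K
    old e∈ e≢x = [ id , (λ e≡x → contradiction e≡x e≢x) ]′ (x∈p∪⁅y⁆⁻ e∈)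

    valid′ : ∀ {e} → e ∈ K ∪ ⁅ x ⁆ → φ′ e ∈ₗ members 𝒞 × e ∈ φ′ e
    valid′ {e} e∈ with e ≟ x
    ... | yes refl = subst (λ T → T ∈ₗ members 𝒞 × x ∈ T) (sym φ′x) (∈N⁻ S∈N)
    ... | no e≢x   =
      subst (λ T → T ∈ₗ members 𝒞 × e ∈ T) (sym (φ′e e≢x)) (valid (old e∈ e≢x))

    inj′ : ∀ e f → e ∈ K ∪ ⁅ x ⁆ → f ∈ K ∪ ⁅ x ⁆ → φ′ e ≡ φ′ f → e ≡ f
    inj′ e f e∈ f∈ eq with e ≟ x | f ≟ x
    ... | yes refl | yes refl = refl
    ... | yes refl | no f≢x   = contradiction
      (trans (sym (φ′e f≢x)) (trans (sym eq) φ′x)) (free (old f∈ f≢x) f≢x)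
    ... | no e≢x   | yes refl = contradiction
      (trans (sym (φ′e e≢x)) (trans eq φ′x)) (free (old e∈ e≢x) e≢x)
    ... | no e≢x   | no f≢x   =
      inj (old e∈ e≢x) (old f∈ f≢x) (trans (sym (φ′e e≢x)) (trans eq (φ′e f≢x)))

  ∅-matching : Matching ⊥ (const ⊥)
  ∅-matching = (λ e∈ → contradiction e∈ ∉⊥) , (λ e∈ → contradiction e∈ ∉⊥)

  ∅-independent : Independent ⊥
  ∅-independent = const ⊥ , ∅-matching

  -- The list records which members may already be in use, so that a new member is known to be free
  -- as soon as it is not in the list.
  Matched : Subset m → List (Subset m) → Set
  Matched K 𝒮 = Σ[ φ ∈ (Fin m → Subset m) ] Matching K φ × (∀ {e} → e ∈ K → φ e ∈ₗ 𝒮)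

  matched⇒independent : ∀ {K 𝒮} → Matched K 𝒮 → Independent K
  matched⇒independent (φ , φ-matching , _) = φ , φ-matching

  ∅-matched : Matched ⊥ []
  ∅-matched = const ⊥ , ∅-matching , λ e∈ → contradiction e∈ ∉⊥

  extend-fresh : ∀ {K 𝒮 S x} → Matched K 𝒮 → S ∈ₗ N x → ¬ S ∈ₗ 𝒮 → Matched (K ∪ ⁅ x ⁆) (S ∷ 𝒮)
  extend-fresh {K} {𝒮} {S} {x} (φ , φ-matching , φ∈𝒮) S∈N S∉𝒮 =
    updateAt φ x (const S) ,
    extend x φ-matching S∈N (λ e∈K _ φe≡S → S∉𝒮 (subst (_∈ₗ 𝒮) φe≡S (φ∈𝒮 e∈K))) ,
    values
    where
    values : ∀ {e} → e ∈ K ∪ ⁅ x ⁆ → updateAt φ x (const S) e ∈ₗ S ∷ 𝒮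
    values {e} e∈ with e ≟ x
    ... | yes refl = here (updateAt-updates x φ)
    ... | no e≢x   with x∈p∪⁅y⁆⁻ e∈
    ...   | inj₁ e∈K = there (subst (_∈ₗ 𝒮) (sym (updateAt-minimal e x φ e≢x)) (φ∈𝒮 e∈K))
    ...   | inj₂ e≡x = contradiction e≡x e≢x

  -- Small sets are written as successive extensions of `⊥`, the form in which `extend-fresh` builds
  -- them.
  singleton-independent : ∀ a → Independent (⊥ ∪ ⁅ a ⁆)
  singleton-independent a =
    matched⇒independent (extend-fresh ∅-matched (proj₂ (N-nonempty a)) λ ())

  pair-independent : ∀ {a b A B} → A ∈ₗ N a → B ∈ₗ N b → A ≢ B → Independent ((⊥ ∪ ⁅ a ⁆) ∪ ⁅ b ⁆)
  pair-independent A∈ B∈ A≢B = matched⇒independent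
    (extend-fresh (extend-fresh ∅-matched A∈ λ ()) B∈ λ { (here B≡A) → A≢B (sym B≡A) })

  triple-independent : ∀ {a b c A B C} → A ∈ₗ N a → B ∈ₗ N b → C ∈ₗ N c → A ≢ B → A ≢ C → B ≢ C →
    Independent (((⊥ ∪ ⁅ a ⁆) ∪ ⁅ b ⁆) ∪ ⁅ c ⁆)
  triple-independent A∈ B∈ C∈ A≢B A≢C B≢C = matched⇒independent
    (extend-fresh
      (extend-fresh (extend-fresh ∅-matched A∈ λ ()) B∈ λ { (here B≡A) → A≢B (sym B≡A) })
      C∈ λ { (here C≡B) → B≢C (sym C≡B) ; (there (here C≡A)) → A≢C (sym C≡A) })

  -- Elements that meet at most two members

  Within : Fin m → Subset m → Subset m → Set
  Within x A B = ∀ {S} → S ∈ₗ N x → S ≡ A ⊎ S ≡ B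

  Branching : Fin m → Set
  Branching x = ∃[ A ] ∃[ B ] A ≢ B × A ∈ₗ N x × B ∈ₗ N x

  -- By Hall's theorem this says that {a, b, c} is dependent.
  Deficient : Fin m → Fin m → Fin m → Set
  Deficient a b c = ∀ {A B C} → A ∈ₗ N a → B ∈ₗ N b → C ∈ₗ N c → A ≢ B → A ≢ C → B ≢ C → False

  length≡2 : ∀ {x A B} → A ≢ B → A ∈ₗ N x → B ∈ₗ N x → Within x A B → length (N x) ≡ 2
  length≡2 {x} {A} {B} A≢B A∈ B∈ within = unique∧set⇒length≡ (N! x) (pair! A≢B) (mk⇔
    (λ S∈ → [ here , (λ S≡B → there (here S≡B)) ]′ (within S∈))
    λ { (here refl) → A∈ ; (there (here refl)) → B∈ })

  -- Two distinct members chosen from A and B must be both of them.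
  length≡2⇒∈ : ∀ {x A B} → length (N x) ≡ 2 → Within x A B → A ∈ₗ N x × B ∈ₗ N x
  length≡2⇒∈ {x} len within with N x | N! x
  length≡2⇒∈ () within | [] | _
  length≡2⇒∈ () within | _ ∷ [] | _
  length≡2⇒∈ () within | _ ∷ _ ∷ _ ∷ _ | _
  length≡2⇒∈ len within | C ∷ D ∷ [] | (C≢D ∷ []) ∷ _
    with within (here refl) | within (there (here refl))
  ... | inj₁ refl | inj₁ refl = contradiction refl C≢D
  ... | inj₁ refl | inj₂ refl = here refl , there (here refl)
  ... | inj₂ refl | inj₁ refl = there (here refl) , here refl
  ... | inj₂ refl | inj₂ refl = contradiction refl C≢D

  -- If d is not in F, a set J with d ∈ J can be changed into one that avoids d: the two sets
  -- A and B are used by at most two of a, b, d, and those two uses can be moved onto a and b.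
  exchange : (∀ X → ∃[ r ] HasRank X r) → ∀ {a b d A B F} → a ≢ b →
    A ∈ₗ N a → B ∈ₗ N a → Within a A B → Within b A B → Within d A B →
    Closed F → a ∈ F → b ∈ F → d ∈ F
  exchange ranked {a} {b} {d} {A} {B} {F} a≢b A∈ B∈ within-a within-b within-d closed a∈F b∈F =
    decidable-stable (d ∈? F) λ d∉F → d∉F (to closed (in-closure d∉F))
    where
    ∈N-a : ∀ {S} → S ≡ A ⊎ S ≡ B → S ∈ₗ N a
    ∈N-a (inj₁ refl) = A∈
    ∈N-a (inj₂ refl) = B∈

    in-closure : d ∉ F → InClosure F d
    in-closure d∉F with ranked F
    ... | r , F-r@((I , I⊆F , ind , ∣I∣≡r) , bound) =
      -- A largest independent subset of F also lies in F ∪ {d}; what remains is that no independent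
      -- subset of F ∪ {d} is larger.
      r , F-r , (I , ⊆-trans I⊆F (p⊆p∪q _) , ind , ∣I∣≡r) , bound′
      where
      bound′ : ∀ {J} → J ⊆ F ∪ ⁅ d ⁆ → Independent J → ∣ J ∣ ≤ r
      bound′ {J} J⊆ (φ , φ-matching@(valid , inj)) with d ∈? J
      ... | no d∉J  = bound J⊆F (φ , φ-matching)
        where
        J⊆F : J ⊆ F
        J⊆F {e} e∈J with x∈p∪⁅y⁆⁻ (J⊆ e∈J)
        ... | inj₁ e∈F  = e∈F
        ... | inj₂ refl = contradiction e∈J d∉J
      ... | yes d∈J = cases (a ∈? J)
        where
        K : Subset m
        K = J - d

        K⊆J : K ⊆ J
        K⊆J = p─q⊆p J ⁅ d ⁆

        ≢d : ∀ {e} → e ∈ K → e ≢ d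
        ≢d e∈K refl = x∉p-x J d e∈K

        K⊆F : K ⊆ F
        K⊆F e∈K with x∈p∪⁅y⁆⁻ (J⊆ (K⊆J e∈K))
        ... | inj₁ e∈F = e∈F
        ... | inj₂ e≡d = contradiction e≡d (≢d e∈K)

        K-matching : Matching K φ
        K-matching = valid ∘ K⊆J , λ e∈ f∈ → inj (K⊆J e∈) (K⊆J f∈)

        φe≢φd : ∀ {e} → e ∈ K → φ e ≢ φ d
        φe≢φd e∈K eq = ≢d e∈K (inj (K⊆J e∈K) d∈J eq)

        φd∈ : φ d ≡ A ⊎ φ d ≡ B
        φd∈ = within-d (∈N⁺ (valid d∈J))

        -- K lost only `d`, and J′ regains at least `y`, so J′ is at least as large as J while lying
        -- inside F.
        larger : ∀ {J′ y} → K ⊆ J′ → y ∈ J′ → y ∉ J → J′ ⊆ F → Independent J′ → ∣ J ∣ ≤ r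
        larger K⊆J′ y∈J′ y∉J J′⊆F ind′ = ≤-trans (∣p∣≤1+∣p-x∣ J d)
          (≤-trans (p⊂q⇒∣p∣<∣q∣ (K⊆J′ , _ , y∈J′ , y∉J ∘ K⊆J)) (bound J′⊆F ind′))

        cases : Dec (a ∈ J) → ∣ J ∣ ≤ r
        -- The member released by `d` is A or B, and `a` lies in both, so `a` can take it.
        cases (no a∉J) =
          larger (p⊆p∪q _) (x∈p∪⁅x⁆ K a) a∉J (p∪⁅x⁆⊆ K⊆F a∈F)
            (_ , extend a K-matching (∈N-a φd∈) λ e∈K _ → φe≢φd e∈K)
        cases (yes a∈J) with N-nonempty b
        ... | T , T∈ with b ∈? J | T ≟ˢ φ d
        -- Here a, b and d would need three distinct members among A and B.
        ...   | yes b∈J | _ = ⊥-elim ([ a≢b ∘ inj a∈J b∈J ,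
                [ (λ eq → d∉F (subst (_∈ F) (inj a∈J d∈J eq) a∈F)) ,
                  (λ eq → d∉F (subst (_∈ F) (inj b∈J d∈J eq) b∈F)) ]′ ]′
                (pigeonhole₃ (within-a (∈N⁺ (valid a∈J))) (within-b (∈N⁺ (valid b∈J))) φd∈))
        -- The member `T` at `b` is the one that `d` released, so `b` takes it directly.
        ...   | no b∉J | yes refl =
          larger (p⊆p∪q _) (x∈p∪⁅x⁆ K b) b∉J (p∪⁅x⁆⊆ K⊆F b∈F)
            (_ , extend b K-matching T∈ λ e∈K _ → φe≢φd e∈K)
        -- Now `T` is in use by `a`. Since `a` lies in both A and B, it moves to the member released
        -- by `d`, and `b` takes `T`.
        ...   | no b∉J | no T≢φd =
          larger (⊆-trans (p⊆p∪q _) (p⊆p∪q _)) (x∈p∪⁅x⁆ (K ∪ ⁅ a ⁆) b) b∉J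
            (p∪⁅x⁆⊆ (p∪⁅x⁆⊆ K⊆F a∈F) b∈F)
            (_ , extend b (extend a K-matching (∈N-a φd∈) λ e∈K _ → φe≢φd e∈K) T∈ T-free)
          where
          a≢d : a ≢ d
          a≢d refl = d∉F a∈F

          φa≢φd : φ a ≢ φ d
          φa≢φd = a≢d ∘ inj a∈J d∈J

          T≡φa : T ≡ φ a
          T≡φa = [ id , [ (λ eq → contradiction eq T≢φd) , (λ eq → contradiction eq φa≢φd) ]′ ]′
            (pigeonhole₃ (within-b T∈) (within-a (∈N⁺ (valid a∈J))) φd∈)

          T-free : ∀ {e} → e ∈ K ∪ ⁅ a ⁆ → e ≢ b → updateAt φ a (const (φ d)) e ≢ T
          T-free {e} e∈ _ eq with e ≟ a
          ... | yes refl = φa≢φd (trans (sym T≡φa) (trans (sym eq) (updateAt-updates a φ)))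
          ... | no e≢a   = e≢a (inj (K⊆J e∈K) a∈J
                             (trans (sym (updateAt-minimal e a φ e≢a)) (trans eq T≡φa)))
            where
            e∈K : e ∈ K
            e∈K = [ id , (λ e≡a → contradiction e≡a e≢a) ]′ (x∈p∪⁅y⁆⁻ e∈)

  -- Coverings of rank at most two, and the size of `ℰ`

  Rank-2 : Set
  Rank-2 = ∃[ A ] ∃[ B ] A ≢ B × (∀ u → Within u A B) × ∃[ x ] A ∈ₗ N x × B ∈ₗ N x

  length-deduplicate : ∀ {S} {Ss : List (Subset m)} → S ∈ₗ Ss → (∀ {T} → T ∈ₗ Ss → T ≡ S) →
    length (deduplicate _≟ˢ_ Ss) ≡ 1
  length-deduplicate {S} {Ss} S∈ only-S = unique∧set⇒length≡ (deduplicate-! _≟ˢ_ Ss) ([] ∷ [])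
    (mk⇔ (λ T∈ → here (only-S (∈-deduplicate⁻ _≟ˢ_ Ss T∈)))
         λ { (here refl) → ∈-deduplicate⁺ _≟ˢ_ S∈ })

  -- An element that meets exactly two members meets A and B, which are all that any element can
  -- meet; hence its set in `ℰ` is the whole of U. The element `x` shows that `ℰ` is not empty.
  rank-2⇒∣ℰ∣≡1 : Rank-2 → length (ℰ 𝒞) ≡ 1
  rank-2⇒∣ℰ∣≡1 (A , B , A≢B , within , x , A∈ , B∈) =
    length-deduplicate (subst (_∈ₗ Es) (E≡⊤ len-x) (∈-map⁺ E⟨ 𝒞 ⟩ (∈-filter⁺ two? (∈-allFin x) len-x)))
      only-⊤
    where
    open DecListSubset _≟ˢ_ using (_⊆?_)

    two? : ∀ y → Dec (length (N y) ≡ 2)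
    two? y = length (N y) ℕ.≟ 2

    Es : List (Subset m)
    Es = map E⟨ 𝒞 ⟩ (filter two? (allFin m))

    len-x : length (N x) ≡ 2
    len-x = length≡2 A≢B A∈ B∈ (within x)

    E≡⊤ : ∀ {y} → length (N y) ≡ 2 → E⟨ 𝒞 ⟩ y ≡ ⊤
    E≡⊤ {y} len = ⊆-antisym ⊆⊤ λ {z} _ → ∈-tabulate⁺ (λ z → N z ⊆? N y) λ S∈ →
      [ (λ { refl → proj₁ (length≡2⇒∈ len (within y)) }) ,
        (λ { refl → proj₂ (length≡2⇒∈ len (within y)) }) ]′ (within z S∈)

    only-⊤ : ∀ {T} → T ∈ₗ Es → T ≡ ⊤
    only-⊤ T∈ with ∈-map⁻ E⟨ 𝒞 ⟩ T∈
    ... | y , y∈ , refl = E≡⊤ (proj₂ (∈-filter⁻ two? {xs = allFin m} y∈))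

  -- Hall's condition for pairs and triples in a simple matroid

  Simple : Set
  Simple = ¬ (∃[ u ] ∃[ v ] u ≢ v × N u ∼[ set ] N v × length (N u) ≡ 1)

  module _ (simple : Simple) where

    abstract
      -- If every member at `u` equals every member at `v`, both lists consist of one common member.
      -- The hypothesis on the covering excludes exactly this, so there are no parallel elements.
      distinct-representatives : ∀ {u v} → u ≢ v → ∃[ A ] ∃[ B ] A ≢ B × A ∈ₗ N u × B ∈ₗ N v
      distinct-representatives {u} {v} u≢v with N-nonempty u | N-nonempty v
      ... | A , A∈ | B , B∈ with Any.any? (λ S → ¬? (A ≟ˢ S)) (N v)
      ...   | yes p = let S , S∈ , A≢S = find p in A , S , A≢S , A∈ , S∈
      ...   | no ¬p with Any.any? (λ S → ¬? (S ≟ˢ B)) (N u)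
      ...     | yes q = let S , S∈ , S≢B = find q in S , B , S≢B , S∈ , B∈
      ...     | no ¬q =
        ⊥-elim (simple (u , v , u≢v , N-u∼N-v , unique∧set⇒length≡ (N! u) ([] ∷ []) N-u∼[B]))
        where
        u-only : ∀ {S} → S ∈ₗ N u → S ≡ B
        u-only {S} S∈ = decidable-stable (S ≟ˢ B) λ S≢B → ¬q (lose S∈ S≢B)

        v-only : ∀ {S} → S ∈ₗ N v → A ≡ S
        v-only {S} S∈ = decidable-stable (A ≟ˢ S) λ A≢S → ¬p (lose S∈ A≢S)

        N-u∼N-v : N u ∼[ set ] N v
        N-u∼N-v = mk⇔ (λ S∈ → subst (_∈ₗ N v) (sym (u-only S∈)) B∈)
                      (λ S∈ → subst (_∈ₗ N u) (v-only S∈) A∈)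

        N-u∼[B] : N u ∼[ set ] (B ∷ [])
        N-u∼[B] = mk⇔ (here ∘ u-only) λ { (here refl) → subst (_∈ₗ N u) (u-only A∈) A∈ }

    abstract
      -- Take distinct A at `a` and B at `b`. Deficiency forces any member at `c` to be one of them,
      -- say A. Distinct representatives of `a` and `c` cannot both be A, so one of these two
      -- elements lies in a second member. The case of B is the same with `b` for `a`.
      deficient⇒branching : ∀ {a b c} → a ≢ b → a ≢ c → b ≢ c → Deficient a b c →
        Branching a ⊎ Branching b ⊎ Branching c
      deficient⇒branching {c = c} a≢b a≢c b≢c deficient
        with distinct-representatives a≢b | N-nonempty c
      ... | A , B , A≢B , A∈ , B∈ | C , C∈ with C ≟ˢ A | C ≟ˢ B
      ...   | no C≢A | no C≢B = ⊥-elim (deficient A∈ B∈ C∈ A≢B (≢-sym C≢A) (≢-sym C≢B))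
      ...   | yes refl | _ with distinct-representatives a≢c
      ...     | A′ , C′ , A′≢C′ , A′∈ , C′∈ with A′ ≟ˢ A
      ...       | yes refl = inj₂ (inj₂ (A , C′ , A′≢C′ , C∈ , C′∈))
      ...       | no A′≢A  = inj₁ (A′ , A , A′≢A , A′∈ , A∈)
      deficient⇒branching {c = c} a≢b a≢c b≢c deficient
        | A , B , A≢B , A∈ , B∈ | C , C∈ | no _ | yes refl with distinct-representatives b≢c
      ...     | B′ , C′ , B′≢C′ , B′∈ , C′∈ with B′ ≟ˢ B
      ...       | yes refl = inj₂ (inj₂ (B , C′ , B′≢C′ , C∈ , C′∈))
      ...       | no B′≢B  = inj₂ (inj₁ (B′ , B , B′≢B , B′∈ , B∈))

    module _ {x A B} (A≢B : A ≢ B) (A∈ : A ∈ₗ N x) (B∈ : B ∈ₗ N x) where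

      avoid : ∀ T → ∃[ X ] X ∈ₗ N x × X ≢ T × (X ≡ A ⊎ X ≡ B)
      avoid T with A ≟ˢ T
      ... | yes refl = B , B∈ , ≢-sym A≢B , inj₂ refl
      ... | no A≢T   = A , A∈ , A≢T , inj₁ refl

      -- Suppose S at `z` is neither A nor B, and choose distinct representatives of `y` and `z`. If
      -- `y` does not use S, let `z` use S; otherwise keep both. Either way `x` has a choice between
      -- A and B that avoids the one remaining conflict, so all three get distinct members.
      deficient⇒within : ∀ {y z} → y ≢ z → Deficient x y z → Within z A B
      deficient⇒within y≢z deficient {S} S∈ with S ≟ˢ A | S ≟ˢ B
      ... | yes S≡A | _ = inj₁ S≡A
      ... | no _ | yes S≡B = inj₂ S≡B
      ... | no S≢A | no S≢B with distinct-representatives y≢z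
      ...   | T , S′ , T≢S′ , T∈ , S′∈ with T ≟ˢ S
      ...     | yes refl with avoid S′
      ...       | X , X∈ , X≢S′ , X∈AB =
        ⊥-elim (deficient X∈ T∈ S′∈ (≢S X∈AB) X≢S′ T≢S′)
        where
        ≢S : ∀ {X} → X ≡ A ⊎ X ≡ B → X ≢ S
        ≢S (inj₁ refl) = ≢-sym S≢A
        ≢S (inj₂ refl) = ≢-sym S≢B
      deficient⇒within y≢z deficient {S} S∈ | no S≢A | no S≢B | T , S′ , T≢S′ , T∈ , S′∈ | no T≢S
        with avoid T
      ... | X , X∈ , X≢T , inj₁ refl = ⊥-elim (deficient X∈ T∈ S∈ X≢T (≢-sym S≢A) T≢S)
      ... | X , X∈ , X≢T , inj₂ refl = ⊥-elim (deficient X∈ T∈ S∈ X≢T (≢-sym S≢B) T≢S)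

      abstract
        -- For `y` and `z` this is `deficient⇒within` and its mirror image. Then distinct
        -- representatives of `y` and `z` use up A and B, and any other member at `x` would complete
        -- a transversal of the triple.
        deficient⇒within-all : ∀ {y z} → y ≢ z → Deficient x y z →
          Within x A B × Within y A B × Within z A B
        deficient⇒within-all {y} {z} y≢z deficient = within-x , within-y , within-z
          where
          within-y : Within y A B
          within-y = deficient⇒within (≢-sym y≢z) λ X∈ Z∈ Y∈ X≢Z X≢Y Z≢Y →
            deficient X∈ Y∈ Z∈ X≢Y X≢Z (≢-sym Z≢Y)

          within-z : Within z A B
          within-z = deficient⇒within y≢z deficient

          within-x : Within x A B
          within-x {S} S∈ with S ≟ˢ A | S ≟ˢ B | distinct-representatives y≢z
          ... | yes S≡A | _ | _ = inj₁ S≡A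
          ... | no _ | yes S≡B | _ = inj₂ S≡B
          ... | no S≢A | no S≢B | T , T′ , T≢T′ , T∈ , T′∈ =
            ⊥-elim (deficient S∈ T∈ T′∈ (S≢ (within-y T∈)) (S≢ (within-z T′∈)) T≢T′)
            where
            S≢ : ∀ {T} → T ≡ A ⊎ T ≡ B → S ≢ T
            S≢ (inj₁ refl) = S≢A
            S≢ (inj₂ refl) = S≢B

    -- Transport along the isomorphism with the partition lattice

    module Lattice {n} (ranked : ∀ X → ∃[ r ] HasRank X r) (iso : P n ≅ L 𝒞) where

      open Ranked Independent ∅-independent ranked
      open IsOrderIsomorphism (proj₂ iso) using (mono; cancel; surjective)

      ⟦_⟧ : Partition n → Subset m
      ⟦ π ⟧ = proj₁ (proj₁ iso π)

      ⟦⟧-closed : ∀ π → Closed ⟦ π ⟧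
      ⟦⟧-closed π = proj₂ (proj₁ iso π)

      ⟦⟧-mono : ∀ π σ → π ≤ₚ σ → ⟦ π ⟧ ⊆ ⟦ σ ⟧
      ⟦⟧-mono π σ = mono {π} {σ}

      ⟦⟧-cancel : ∀ π σ → ⟦ π ⟧ ⊆ ⟦ σ ⟧ → π ≤ₚ σ
      ⟦⟧-cancel π σ = cancel {π} {σ}

      abstract
        partition-of : ∀ {F} → Closed F → ∃[ π ] ⟦ π ⟧ ≡ F
        partition-of {F} closed with surjective (F , λ {e} → closed {e})
        ... | π , ≡F = π , ≡F {π} (Poset.Eq.refl (P n) {π})

      ∅-closed : Closed ⊥
      ∅-closed = independent-extensions⇒closed λ {e} _ → singleton-independent e

      singleton-closed : ∀ u → Closed (⊥ ∪ ⁅ u ⁆)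
      singleton-closed u = independent-extensions⇒closed ext
        where
        ext : ∀ {e} → e ∉ ⊥ ∪ ⁅ u ⁆ → Independent ((⊥ ∪ ⁅ u ⁆) ∪ ⁅ e ⁆)
        ext {e} e∉ with distinct-representatives {u} {e} (λ { refl → e∉ (x∈p∪⁅x⁆ ⊥ u) })
        ... | A , B , A≢B , A∈ , B∈ = pair-independent A∈ B∈ A≢B

      ∈singleton⇒≡ : ∀ {u v : Fin m} → v ∈ ⊥ ∪ ⁅ u ⁆ → v ≡ u
      ∈singleton⇒≡ v∈ = [ (λ v∈⊥ → contradiction v∈⊥ ∉⊥) , id ]′ (x∈p∪⁅y⁆⁻ v∈)

      -- u is the element of the ground set that corresponds to the atom whose only
      -- nontrivial block is {i, j}.
      record Point (i j : Fin n) (u : Fin m) : Set where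
        constructor mkPoint
        field
          ∈⇔same : ∀ π → u ∈ ⟦ π ⟧ ⇔ Same π i j

      open Point

      point-sym : ∀ {i j u} → Point i j u → Point j i u
      point-sym p = mkPoint λ π → mk⇔ (same-sym π ∘ to (∈⇔same p π)) (from (∈⇔same p π) ∘ same-sym π)

      abstract
        -- The flat of the partition π joining only i and j contains some `u` outside the flat of
        -- the discrete partition `merge ⊥`. The closed set {u} belongs to some σ below π. Since σ
        -- is not discrete, it joins i and j, so containing `u` means lying above π.
        point : ∀ {i j} → i ≢ j → ∃[ u ] Point i j u
        point {i} {j} i≢j with any? (λ u → (u ∈? ⟦ merge (⁅ i ⁆ ∪ ⁅ j ⁆) ⟧) ×-dec ¬? (u ∈? ⟦ merge ⊥ ⟧))
        ... | no none = ⊥-elim ([ i≢j , ∉⊥ ∘ proj₁ ]′ (same-merge⁻ ⊥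
          (≤ₚ⇒same {π = π} {merge ⊥} (⟦⟧-cancel π (merge ⊥) λ {u} u∈ →
            decidable-stable (u ∈? _) λ u∉ → none (u , u∈ , u∉))
            (same-merge⁺ _ (x∈p∪q⁺ (inj₁ (x∈⁅x⁆ i))) (x∈p∪q⁺ (inj₂ (x∈⁅x⁆ j)))))))
          where
          π : Partition n
          π = merge (⁅ i ⁆ ∪ ⁅ j ⁆)
        ... | yes (u , u∈π , u∉0) with partition-of (singleton-closed u)
        ...   | σ , ⟦σ⟧≡ = u , mkPoint λ τ → mk⇔
          (λ u∈τ → ≤ₚ⇒same {π = σ} {τ} (σ≤ τ u∈τ) same-σ)
          (λ same-τ → ⟦⟧-mono π τ
            (same⇒≤ₚ {π = π} {τ} (λ same-π → π≤ τ same-τ (same-merge⁻ _ same-π))) u∈π)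
          where
          π : Partition n
          π = merge (⁅ i ⁆ ∪ ⁅ j ⁆)

          σ≤ : ∀ τ → u ∈ ⟦ τ ⟧ → σ ≤ₚ τ
          σ≤ τ u∈τ = ⟦⟧-cancel σ τ (subst (_⊆ ⟦ τ ⟧) (sym ⟦σ⟧≡) (p∪⁅x⁆⊆ ⊥⊆ u∈τ))

          π≤ : ∀ τ → Same τ i j → ∀ {p q} → p ≡ q ⊎ (p ∈ ⁅ i ⁆ ∪ ⁅ j ⁆ × q ∈ ⁅ i ⁆ ∪ ⁅ j ⁆) → Same τ p q
          π≤ τ same {p} (inj₁ refl) = same-refl τ p
          π≤ τ same (inj₂ (p∈ , q∈)) with x∈p∪⁅y⁆⁻ p∈ | x∈p∪⁅y⁆⁻ q∈
          ... | inj₂ refl | inj₂ refl = same-refl τ _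
          ... | inj₁ p∈i  | inj₂ refl rewrite x∈⁅y⁆⇒x≡y i p∈i = same
          ... | inj₂ refl | inj₁ q∈i  rewrite x∈⁅y⁆⇒x≡y i q∈i = same-sym τ same
          ... | inj₁ p∈i  | inj₁ q∈i
            rewrite x∈⁅y⁆⇒x≡y i p∈i | x∈⁅y⁆⇒x≡y i q∈i = same-refl τ i

          same-σ : Same σ i j
          -- Lying below π, the partition σ can join no other pair. If it did not join i and j, it
          -- would be discrete, and `u` would lie in the flat of `merge ⊥`.
          same-σ = decidable-stable (same? σ i j) λ ¬same → u∉0
            (⟦⟧-mono σ (merge ⊥) (same⇒≤ₚ {π = σ} {merge ⊥} (discrete ¬same))
              (subst (u ∈_) (sym ⟦σ⟧≡) (x∈p∪⁅x⁆ ⊥ u)))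
            where
            discrete : ¬ Same σ i j → ∀ {p q} → Same σ p q → Same (merge ⊥) p q
            discrete ¬same {p} {q} same with same-merge⁻ _ (≤ₚ⇒same {π = σ} {π} (σ≤ π u∈π) same)
            ... | inj₁ refl = same-refl (merge ⊥) p
            ... | inj₂ (p∈ , q∈) with x∈p∪⁅y⁆⁻ p∈ | x∈p∪⁅y⁆⁻ q∈
            ...   | inj₂ refl | inj₂ refl = same-refl (merge ⊥) p
            ...   | inj₁ p∈i  | inj₂ refl rewrite x∈⁅y⁆⇒x≡y i p∈i = contradiction same ¬same
            ...   | inj₂ refl | inj₁ q∈i  rewrite x∈⁅y⁆⇒x≡y i q∈i = contradiction (same-sym σ same) ¬same
            ...   | inj₁ p∈i  | inj₁ q∈i
              rewrite x∈⁅y⁆⇒x≡y i p∈i | x∈⁅y⁆⇒x≡y i q∈i = same-refl (merge ⊥) i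

      abstract
        -- The partition σ of the flat {u} joins some distinct i and j, for otherwise it would lie
        -- below the partition of the empty flat. The point of i and j then lies in {u}.
        every-element-is-point : ∀ u → ∃[ i ] ∃[ j ] i ≢ j × Point i j u
        every-element-is-point u with partition-of (singleton-closed u) | partition-of ∅-closed
        ... | σ , ⟦σ⟧≡ | τ , ⟦τ⟧≡ with any? (λ i → any? (λ j → ¬? (i ≟ j) ×-dec same? σ i j))
        ...   | yes (i , j , i≢j , same) with point i≢j
        ...     | v , pv = i , j , i≢j ,
          subst (Point i j) (∈singleton⇒≡ (subst (v ∈_) ⟦σ⟧≡ (from (∈⇔same pv σ) same))) pv
        every-element-is-point u | σ , ⟦σ⟧≡ | τ , ⟦τ⟧≡ | no none =
          contradiction (subst (u ∈_) ⟦τ⟧≡ (⟦⟧-mono σ τ (same⇒≤ₚ {π = σ} {τ} discrete)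
            (subst (u ∈_) (sym ⟦σ⟧≡) (x∈p∪⁅x⁆ ⊥ u)))) ∉⊥
          where
          discrete : ∀ {i j} → Same σ i j → Same τ i j
          discrete {i} {j} same with i ≟ j
          ... | yes refl = same-refl τ i
          ... | no i≢j   = contradiction (i , j , i≢j , same) none

      point-unique : ∀ {i j u v} → Point i j u → Point i j v → u ≡ v
      point-unique {u = u} {v} pu pv with partition-of (singleton-closed v)
      ... | σ , ⟦σ⟧≡ = ∈singleton⇒≡ (subst (u ∈_) ⟦σ⟧≡
        (from (∈⇔same pu σ) (to (∈⇔same pv σ) (subst (v ∈_) (sym ⟦σ⟧≡) (x∈p∪⁅x⁆ ⊥ v)))))

      -- The partition joining only i and j separates the two points, since it does not join i with
      -- k.
      points-≢ : ∀ {i j k a b} → i ≢ k → j ≢ k → Point i j a → Point i k b → a ≢ b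
      points-≢ {i} {j} {k} i≢k j≢k pa pb refl with same-merge⁻ (⁅ i ⁆ ∪ ⁅ j ⁆)
        (to (∈⇔same pb π) (from (∈⇔same pa π) (same-merge⁺ (⁅ i ⁆ ∪ ⁅ j ⁆)
          (x∈p∪q⁺ (inj₁ (x∈⁅x⁆ i))) (x∈p∪q⁺ (inj₂ (x∈⁅x⁆ j))))))
        where
        π : Partition n
        π = merge (⁅ i ⁆ ∪ ⁅ j ⁆)
      ... | inj₁ i≡k = i≢k i≡k
      ... | inj₂ (_ , k∈) with x∈p∪⁅y⁆⁻ k∈
      ...   | inj₁ k∈i  = i≢k (sym (x∈⁅y⁆⇒x≡y i k∈i))
      ...   | inj₂ refl = j≢k refl

      third-point∉ : ∀ {i j k a b c} → i ≢ j → i ≢ k → j ≢ k →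
        Point i j a → Point i k b → Point j k c → c ∉ (⊥ ∪ ⁅ a ⁆) ∪ ⁅ b ⁆
      third-point∉ i≢j i≢k j≢k pa pb pc c∈ with x∈p∪⁅y⁆⁻ c∈
      ... | inj₁ c∈a = points-≢ j≢k i≢k (point-sym pa) pc (sym (∈singleton⇒≡ c∈a))
      ... | inj₂ c≡b = points-≢ (≢-sym j≢k) i≢j (point-sym pb) (point-sym pc) (sym c≡b)

      -- If a, b and c had distinct members, some flat would contain `a` and `b` but not `c`. Its
      -- partition joins i with j and i with k, hence j with k, so the flat contains `c` after all.
      triangle-deficient : ∀ {i j k a b c} → i ≢ j → i ≢ k → j ≢ k →
        Point i j a → Point i k b → Point j k c → Deficient a b c
      triangle-deficient {a = a} {b} {c} i≢j i≢k j≢k pa pb pc A∈ B∈ C∈ A≢B A≢C B≢C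
        with separating-flat (third-point∉ i≢j i≢k j≢k pa pb pc)
               (triple-independent A∈ B∈ C∈ A≢B A≢C B≢C)
      ... | F , closed , ab⊆F , c∉F with partition-of closed
      ...   | σ , refl = c∉F (from (∈⇔same pc σ) (same-trans σ
              (same-sym σ (to (∈⇔same pa σ) (ab⊆F (p⊆p∪q _ (x∈p∪⁅x⁆ ⊥ a)))))
              (to (∈⇔same pb σ) (ab⊆F (x∈p∪⁅x⁆ (⊥ ∪ ⁅ a ⁆) b)))))

      triangle-branching : ∀ {i j k a b c} → i ≢ j → i ≢ k → j ≢ k →
        Point i j a → Point i k b → Point j k c → Branching a ⊎ Branching b ⊎ Branching c
      triangle-branching i≢j i≢k j≢k pa pb pc = deficient⇒branching
        (points-≢ i≢k j≢k pa pb)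
        (points-≢ j≢k i≢k (point-sym pa) pc)
        (points-≢ (≢-sym j≢k) i≢j (point-sym pb) (point-sym pc))
        (triangle-deficient i≢j i≢k j≢k pa pb pc)

      -- The triangles ijk and ijl both contain a, so both use only the two sets through a.
      -- Hence the point of il lies in the flat spanned by the triangle ijk.
      ¬branching : ∀ {i j k l a b} → i ≢ j → i ≢ k → j ≢ k → i ≢ l → j ≢ l → k ≢ l →
        Point i j a → Point i k b → ¬ Branching a
      ¬branching {i} {j} {k} {l} {a} {b} i≢j i≢k j≢k i≢l j≢l k≢l pa pb (A , B , A≢B , A∈ , B∈)
        with point j≢k | point i≢l | point j≢l
      ... | c , pc | d , pd | e , pe
        with deficient⇒within-all A≢B A∈ B∈ (points-≢ (≢-sym j≢k) i≢j (point-sym pb) (point-sym pc))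
               (triangle-deficient i≢j i≢k j≢k pa pb pc)
           | deficient⇒within-all A≢B A∈ B∈ (points-≢ (≢-sym j≢l) i≢j (point-sym pd) (point-sym pe))
               (triangle-deficient i≢j i≢l j≢l pa pd pe)
      ... | within-a , within-b , _ | _ , within-d , _ with same-merge⁻ X (to (∈⇔same pd (merge X))
              (exchange ranked (points-≢ i≢k j≢k pa pb) A∈ B∈ within-a within-b within-d
                (⟦⟧-closed (merge X))
                (from (∈⇔same pa (merge X)) (same-merge⁺ X i∈ j∈))
                (from (∈⇔same pb (merge X)) (same-merge⁺ X i∈ k∈))))
        where
        X = (⁅ i ⁆ ∪ ⁅ j ⁆) ∪ ⁅ k ⁆
        i∈ = p⊆p∪q _ (p⊆p∪q _ (x∈⁅x⁆ i))
        j∈ = p⊆p∪q _ (x∈p∪⁅x⁆ ⁅ i ⁆ j)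
        k∈ = x∈p∪⁅x⁆ (⁅ i ⁆ ∪ ⁅ j ⁆) k
      ...   | inj₁ i≡l = i≢l i≡l
      ...   | inj₂ (_ , l∈) with x∈p∪⁅y⁆⁻ l∈
      ...     | inj₂ l≡k = k≢l (sym l≡k)
      ...     | inj₁ l∈′ with x∈p∪⁅y⁆⁻ l∈′
      ...       | inj₂ l≡j = j≢l (sym l≡j)
      ...       | inj₁ l∈i = i≢l (sym (x∈⁅y⁆⇒x≡y i l∈i))

      -- Whichever edge of the triangle ijk branches, a permutation of i, j, k turns it into the
      -- edge ij, with l still outside.
      ¬four-elements : ∀ {i j k l} → i ≢ j → i ≢ k → j ≢ k → i ≢ l → j ≢ l → k ≢ l → False
      ¬four-elements i≢j i≢k j≢k i≢l j≢l k≢l with point i≢j | point i≢k | point j≢k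
      ... | a , pa | b , pb | c , pc with triangle-branching i≢j i≢k j≢k pa pb pc
      ...   | inj₁ branching        = ¬branching i≢j i≢k j≢k i≢l j≢l k≢l pa pb branching
      ...   | inj₂ (inj₁ branching) =
        ¬branching i≢k i≢j (≢-sym j≢k) i≢l k≢l j≢l pb pa branching
      ...   | inj₂ (inj₂ branching) =
        ¬branching j≢k (≢-sym i≢j) (≢-sym i≢k) j≢l k≢l i≢l pc (point-sym pa) branching

      -- A triangle whose three indices are all there are

      module _ {i j k : Fin n} (i≢j : i ≢ j) (i≢k : i ≢ k) (j≢k : j ≢ k)
               (exhaustive : ∀ l → l ≡ i ⊎ l ≡ j ⊎ l ≡ k)
               {a b c : Fin m} (pa : Point i j a) (pb : Point i k b) (pc : Point j k c) where

        a≢b : a ≢ b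
        a≢b = points-≢ i≢k j≢k pa pb

        a≢c : a ≢ c
        a≢c = points-≢ j≢k i≢k (point-sym pa) pc

        b≢c : b ≢ c
        b≢c = points-≢ (≢-sym j≢k) i≢j (point-sym pb) (point-sym pc)

        vertex : Fin 3 → Fin m
        vertex 0F = a
        vertex 1F = b
        vertex 2F = c

        vertex-injective : ∀ {s t} → vertex s ≡ vertex t → s ≡ t
        vertex-injective {0F} {0F} _  = refl
        vertex-injective {0F} {1F} eq = contradiction eq a≢b
        vertex-injective {0F} {2F} eq = contradiction eq a≢c
        vertex-injective {1F} {0F} eq = contradiction (sym eq) a≢b
        vertex-injective {1F} {1F} _  = refl
        vertex-injective {1F} {2F} eq = contradiction eq b≢c
        vertex-injective {2F} {0F} eq = contradiction (sym eq) a≢c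
        vertex-injective {2F} {1F} eq = contradiction (sym eq) b≢c
        vertex-injective {2F} {2F} _  = refl

        point⇒vertex : ∀ p q {u} → p ≢ q → Point p q u → ∃[ t ] vertex t ≡ u
        point⇒vertex p q p≢q pu with exhaustive p | exhaustive q
        ... | inj₁ refl        | inj₁ refl        = contradiction refl p≢q
        ... | inj₁ refl        | inj₂ (inj₁ refl) = 0F , point-unique pa pu
        ... | inj₁ refl        | inj₂ (inj₂ refl) = 1F , point-unique pb pu
        ... | inj₂ (inj₁ refl) | inj₁ refl        = 0F , point-unique pa (point-sym pu)
        ... | inj₂ (inj₁ refl) | inj₂ (inj₁ refl) = contradiction refl p≢q
        ... | inj₂ (inj₁ refl) | inj₂ (inj₂ refl) = 2F , point-unique pc pu
        ... | inj₂ (inj₂ refl) | inj₁ refl        = 1F , point-unique pb (point-sym pu)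
        ... | inj₂ (inj₂ refl) | inj₂ (inj₁ refl) = 2F , point-unique pc (point-sym pu)
        ... | inj₂ (inj₂ refl) | inj₂ (inj₂ refl) = contradiction refl p≢q

        abstract
          vertex-surjective : ∀ u → ∃[ t ] vertex t ≡ u
          vertex-surjective u with every-element-is-point u
          ... | p , q , p≢q , pu = point⇒vertex p q p≢q pu

        m≡3 : m ≡ 3
        -- The chosen section of `vertex` injects `Fin m` into `Fin 3`, and `vertex` itself injects
        -- `Fin 3` into `Fin m`.
        m≡3 = ≤-antisym
          (injective⇒≤ {f = proj₁ ∘ vertex-surjective} λ {u} {v} eq →
            trans (sym (proj₂ (vertex-surjective u)))
              (trans (cong vertex eq) (proj₂ (vertex-surjective v))))
          (injective⇒≤ {f = vertex} vertex-injective)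

        within-all : ∀ {A B} → Within a A B → Within b A B → Within c A B → ∀ u → Within u A B
        within-all within-a within-b within-c u with vertex-surjective u
        ... | 0F , refl = within-a
        ... | 1F , refl = within-b
        ... | 2F , refl = within-c

        abc-deficient : Deficient a b c
        abc-deficient = triangle-deficient i≢j i≢k j≢k pa pb pc

        rank-2 : Rank-2
        rank-2 with deficient⇒branching a≢b a≢c b≢c abc-deficient
        ... | inj₁ (A , B , A≢B , A∈ , B∈) =
          let wa , wb , wc = deficient⇒within-all A≢B A∈ B∈ b≢c abc-deficient
          in A , B , A≢B , within-all wa wb wc , a , A∈ , B∈
        -- The triple is reordered so that its branching element comes first, where
        -- `deficient⇒within-all` expects it.
        ... | inj₂ (inj₁ (A , B , A≢B , A∈ , B∈)) =
          let wb , wa , wc = deficient⇒within-all A≢B A∈ B∈ a≢c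
                λ Y∈ X∈ Z∈ Y≢X Y≢Z X≢Z → abc-deficient X∈ Y∈ Z∈ (≢-sym Y≢X) X≢Z Y≢Z
          in A , B , A≢B , within-all wa wb wc , b , A∈ , B∈
        ... | inj₂ (inj₂ (A , B , A≢B , A∈ , B∈)) =
          let wc , wa , wb = deficient⇒within-all A≢B A∈ B∈ a≢b
                λ Z∈ X∈ Y∈ Z≢X Z≢Y X≢Y → abc-deficient X∈ Y∈ Z∈ X≢Y (≢-sym Z≢X) (≢-sym Z≢Y)
          in A , B , A≢B , within-all wa wb wc , c , A∈ , B∈

      three-elements : ∀ {i j k : Fin n} → i ≢ j → i ≢ k → j ≢ k →
        (∀ l → l ≡ i ⊎ l ≡ j ⊎ l ≡ k) → m ≡ 3 × Rank-2
      three-elements i≢j i≢k j≢k exhaustive with point i≢j | point i≢k | point j≢k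
      ... | a , pa | b , pb | c , pc =
        m≡3 i≢j i≢k j≢k exhaustive pa pb pc , rank-2 i≢j i≢k j≢k exhaustive pa pb pc

-- The bound on n and the case of three indices

theorem4p10 : ∀ (m : ℕ) (𝒞 : Covering m) →
    ¬ (∃[ u ] ∃[ v ] u ≢ v × (𝒞 ⟨ ⁅ u ⁆ ⟩) ∼[ set ] (𝒞 ⟨ ⁅ v ⁆ ⟩) × length (𝒞 ⟨ ⁅ u ⁆ ⟩) ≡ 1) →
    ∀ (n : ℕ) → n ≥ 1 → P n ≅ L 𝒞 →
    n ≤ 3 × (n ≡ 3 → m ≡ 3 × length (ℰ 𝒞) ≡ 1)
theorem4p10 m 𝒞 simple n _ iso = decidable-stable
  ((n ≤? 3) ×-dec ((n ℕ.≟ 3) →-dec ((m ℕ.≟ 3) ×-dec (length (ℰ 𝒞) ℕ.≟ 1))))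
  λ ¬goal → ¬¬-∀Subset (¬¬-hasRank (Independent 𝒞) (∅-independent 𝒞)) λ ranked →
    ¬goal (n≤3 n iso ranked , n≡3⇒ n iso ranked)
  where
  n≡3⇒ : ∀ n → P n ≅ L 𝒞 → (∀ X → ∃[ r ] Matroid.HasRank (Independent 𝒞) X r) →
    n ≡ 3 → m ≡ 3 × length (ℰ 𝒞) ≡ 1
  n≡3⇒ _ iso ranked refl with Lattice.three-elements 𝒞 simple ranked iso
    {0F} {1F} {2F} (λ ()) (λ ()) (λ ())
    (λ { 0F → inj₁ refl ; 1F → inj₂ (inj₁ refl) ; 2F → inj₂ (inj₂ refl) })
  ... | m≡3 , rank-2 = m≡3 , rank-2⇒∣ℰ∣≡1 𝒞 rank-2

  n≤3 : ∀ n → P n ≅ L 𝒞 → (∀ X → ∃[ r ] Matroid.HasRank (Independent 𝒞) X r) → n ≤ 3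
  n≤3 0 _ _ = z≤n
  n≤3 1 _ _ = s≤s z≤n
  n≤3 2 _ _ = s≤s (s≤s z≤n)
  n≤3 3 _ _ = ≤-refl
  n≤3 (suc (suc (suc (suc n)))) iso ranked = ⊥-elim (Lattice.¬four-elements 𝒞 simple ranked iso
    {0F} {1F} {2F} {3F} (λ ()) (λ ()) (λ ()) (λ ()) (λ ()) (λ ()))
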